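{- Let $(X_n)$ be a sequence of finite sets and let $(\mathcal{F}_n)$ be a sequence of nontrivial upper sets $\mathcal{F}_n \subseteq 2^{X_n}$. Let $K>0$ be a constant such that $p_c(\mathcal{F}_n)\leq K q(\mathcal{F}_n)\log \ell(\mathcal{F}_n)$ for all $n$. If $\ell(\mathcal{F}_n)\to\infty$ and the Kahn-Kalai bounds provide nontrivial information for $(\mathcal{F}_n)$, then $|(\mathcal{F}_n)_0|\to\infty$.
   Context: For a finite set $X$, an upper set is a subset $\mathcal{F}\subseteq 2^X$ such that $A\in\mathcal{F}$ and $A\subseteq B\subseteq X$ imply $B\in\mathcal{F}$; it is nontrivial if $\mathcal{F}\neq\emptyset$ and $\mathcal{F}\neq 2^X$. For $p\in[0,1]$ let $\mu_p(\mathcal{F})=\sum_{S\in\mathcal{F}}p^{|S|}(1-p)^{|X|-|S|}$; for nontrivial $\mathcal{F}$, the critical probability $p_c(\mathcal{F})$ is the unique $p\in[0,1]$ with $\mu_p(\mathcal{F})=\frac12$. For $S\subseteq X$ let $\langle S\rangle=\{T\subseteq X: S\subseteq T\}$. A set $\mathcal{G}\subseteq 2^X$ is a cover of $\mathcal{F}$ if $\mathcal{F}\subseteq\bigcup_{S\in\mathcal{G}}\langle S\rangle$. $\mathcal{F}$ is $p$-small if it has a cover $\mathcal{G}$ with $\sum_{S\in\mathcal{G}}p^{|S|}\leq\frac12$. The expectation threshold $q(\mathcal{F})$ is the largest $p\in[0,1]$ for which $\mathcal{F}$ is $p$-small. $\mathcal{F}_0$ denotes the set of (inclusion-)minimal elements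 of $\mathcal{F}$ (so $(\mathcal{F}_n)_0$ is the set of minimal elements of $\mathcal{F}_n$), $\ell_0(\mathcal{F})=\max\{|S|:S\in\mathcal{F}_0\}$ and $\ell(\mathcal{F})=\max\{\ell_0(\mathcal{F}),2\}$. $\log$ is the logarithm to base 2. The Kahn-Kalai bounds provide nontrivial information for $(\mathcal{F}_n)$ if there exists $N$ such that $Kq(\mathcal{F}_n)\log\ell(\mathcal{F}_n)<1$ for all $n\geq N$. -}

module Defs where

open import Data.Bool.Base using (Bool; T)
open import Data.Bool.Properties using (T?)
open import Data.Fin.Subset using (Subset; inside; outside; _⊆_; _⊂_; ∣_∣)
open import Data.Fin.Subset.Properties using (_⊂?_; anySubset?)
open import Data.Integer.Base as ℤ using (+_)
import Data.Integer.Properties as ℤ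
open import Data.List.Base using (List; []; _∷_; _++_; map; foldr; filterᵇ; length)
open import Data.List.Extrema.Nat using (max)
open import Data.Nat.Base as ℕ using (ℕ; zero; suc; z≤n; s≤s; _∸_; _⊔_)
open import Data.Nat.Induction using (<-rec)
open import Data.Nat.Logarithm using (⌊log₂_⌋; ⌊log₂⌊n/2⌋⌋≡⌊log₂n⌋∸1)
import Data.Nat.Properties as ℕ
open import Data.Product.Base using (Σ; ∃; _×_; _,_)
open import Data.Rational.Base as ℚ using (ℚ; mkℚ; 0ℚ; 1ℚ; ½)
import Data.Rational.Properties as ℚ
open import Data.Rational.Solver using (module +-*-Solver)
open import Data.Rational.Unnormalised.Base as ℚᵘ using (mkℚᵘ)
import Data.Rational.Unnormalised.Properties as ℚᵘ
open import Data.Sum.Base using (inj₁; inj₂)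
import Data.Vec.Base as Vec
open import Relation.Binary.PropositionalEquality
  using (_≡_; refl; sym; trans; cong; cong₂; subst; subst₂)
open import Relation.Nullary using (Dec; ¬_)
open import Relation.Nullary.Decidable using (isYes; _×-dec_; ¬?)

------------------------------------------------------------------------
-- Real numbers: Cauchy sequences of rationals.  The carrier is not
-- quotiented; equality of reals is the relation _≈_ below.

IsCauchy : (ℕ → ℚ) → Set
IsCauchy x = ∀ ε → 0ℚ ℚ.< ε →
  ∃ λ N → ∀ m n → N ℕ.≤ m → N ℕ.≤ n → ℚ.∣ x m ℚ.- x n ∣ ℚ.< ε

record ℝ : Set where
  constructor mkℝ
  field
    seq    : ℕ → ℚ
    cauchy : IsCauchy seq

open ℝ public

infix 4 _≈_ _≤_ _<_

_≈_ : ℝ → ℝ → Set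
x ≈ y = ∀ ε → 0ℚ ℚ.< ε →
  ∃ λ N → ∀ n → N ℕ.≤ n → ℚ.∣ seq x n ℚ.- seq y n ∣ ℚ.≤ ε

_≤_ : ℝ → ℝ → Set
x ≤ y = ∀ ε → 0ℚ ℚ.< ε →
  ∃ λ N → ∀ n → N ℕ.≤ n → seq x n ℚ.≤ seq y n ℚ.+ ε

_<_ : ℝ → ℝ → Set
x < y = ∃ λ ε → 0ℚ ℚ.< ε ×
  ∃ λ N → ∀ n → N ℕ.≤ n → seq x n ℚ.+ ε ℚ.≤ seq y n

private
  half>0 : ∀ {ε} → 0ℚ ℚ.< ε → 0ℚ ℚ.< ½ ℚ.* ε
  half>0 {ε} ε>0 = subst (ℚ._< ½ ℚ.* ε) (ℚ.*-zeroʳ ½) (ℚ.*-monoʳ-<-pos ½ ε>0)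

  half+half : ∀ ε → ½ ℚ.* ε ℚ.+ ½ ℚ.* ε ≡ ε
  half+half ε = trans (sym (ℚ.*-distribʳ-+ ε ½ ½)) (ℚ.*-identityˡ ε)

  +-cauchy : ∀ {x y} → IsCauchy x → IsCauchy y → IsCauchy (λ n → x n ℚ.+ y n)
  +-cauchy {x} {y} cx cy ε ε>0 with cx (½ ℚ.* ε) (half>0 ε>0) | cy (½ ℚ.* ε) (half>0 ε>0)
  ... | M , hM | N , hN = M ⊔ N , λ m n m≥ n≥ → begin-strict
    ℚ.∣ (x m ℚ.+ y m) ℚ.- (x n ℚ.+ y n) ∣
      ≡⟨ cong ℚ.∣_∣ (regroup (x m) (y m) (x n) (y n)) ⟩
    ℚ.∣ (x m ℚ.- x n) ℚ.+ (y m ℚ.- y n) ∣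
      ≤⟨ ℚ.∣p+q∣≤∣p∣+∣q∣ (x m ℚ.- x n) (y m ℚ.- y n) ⟩
    ℚ.∣ x m ℚ.- x n ∣ ℚ.+ ℚ.∣ y m ℚ.- y n ∣
      <⟨ ℚ.+-mono-< (hM m n (ℕ.m⊔n≤o⇒m≤o M N m≥) (ℕ.m⊔n≤o⇒m≤o M N n≥))
                    (hN m n (ℕ.m⊔n≤o⇒n≤o M N m≥) (ℕ.m⊔n≤o⇒n≤o M N n≥)) ⟩
    ½ ℚ.* ε ℚ.+ ½ ℚ.* ε
      ≡⟨ half+half ε ⟩
    ε ∎
    where
      open ℚ.≤-Reasoning
      regroup : ∀ a b c d → (a ℚ.+ b) ℚ.- (c ℚ.+ d) ≡ (a ℚ.- c) ℚ.+ (b ℚ.- d)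
      regroup = solve 4 (λ a b c d → (a :+ b) :- (c :+ d) := (a :- c) :+ (b :- d)) refl
        where open +-*-Solver

  neg-cauchy : ∀ {x} → IsCauchy x → IsCauchy (λ n → ℚ.- x n)
  neg-cauchy {x} cx ε ε>0 with cx ε ε>0
  ... | N , hN = N , λ m n m≥ n≥ →
    subst (ℚ._< ε)
      (trans (sym (ℚ.∣-p∣≡∣p∣ (x m ℚ.- x n))) (cong ℚ.∣_∣ (ℚ.neg-distrib-+ (x m) (ℚ.- x n))))
      (hN m n m≥ n≥)

  bounded : ∀ {x} → IsCauchy x →
    ∃ λ B → 0ℚ ℚ.< B × ∃ λ N → ∀ n → N ℕ.≤ n → ℚ.∣ x n ∣ ℚ.≤ B
  bounded {x} cx with cx 1ℚ (ℚ.positive⁻¹ 1ℚ)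
  ... | N , hN = B , B>0 , N , bound
    where
      B = 1ℚ ℚ.+ ℚ.∣ x N ∣
      B>0 = ℚ.+-mono-<-≤ (ℚ.positive⁻¹ 1ℚ) (ℚ.0≤∣p∣ (x N))
      split : ∀ a b → a ≡ (a ℚ.- b) ℚ.+ b
      split = solve 2 (λ a b → a := (a :- b) :+ b) refl where open +-*-Solver
      bound : ∀ n → N ℕ.≤ n → ℚ.∣ x n ∣ ℚ.≤ B
      bound n n≥ = begin
        ℚ.∣ x n ∣                        ≡⟨ cong ℚ.∣_∣ (split (x n) (x N)) ⟩
        ℚ.∣ (x n ℚ.- x N) ℚ.+ x N ∣      ≤⟨ ℚ.∣p+q∣≤∣p∣+∣q∣ (x n ℚ.- x N) (x N) ⟩
        ℚ.∣ x n ℚ.- x N ∣ ℚ.+ ℚ.∣ x N ∣  ≤⟨ ℚ.+-monoˡ-≤ ℚ.∣ x N ∣ (ℚ.<⇒≤ (hN n N n≥ ℕ.≤-refl)) ⟩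
        B ∎
        where open ℚ.≤-Reasoning

  divide : ∀ B ε → 0ℚ ℚ.< B → 0ℚ ℚ.< ε → ∃ λ δ → 0ℚ ℚ.< δ × B ℚ.* δ ≡ ε
  divide B ε B>0 ε>0 = ε ℚ.* 1/B , δ>0 , eq
    where
      instance
        B-pos = ℚ.positive B>0
        B≢0 = ℚ.pos⇒nonZero B
      1/B = ℚ.1/ B
      δ>0 : 0ℚ ℚ.< ε ℚ.* 1/B
      δ>0 = subst (ℚ._< ε ℚ.* 1/B) (ℚ.*-zeroˡ 1/B)
        (ℚ.*-monoˡ-<-pos 1/B {{ℚ.1/pos⇒pos B}} ε>0)
      eq : B ℚ.* (ε ℚ.* 1/B) ≡ ε
      eq = trans (cong (B ℚ.*_) (ℚ.*-comm ε 1/B))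
        (trans (sym (ℚ.*-assoc B 1/B ε))
          (trans (cong (ℚ._* ε) (ℚ.*-inverseʳ B)) (ℚ.*-identityˡ ε)))

  *-close : ∀ a b c d A B {δ η} → 0ℚ ℚ.< A → 0ℚ ℚ.< B →
    ℚ.∣ a ∣ ℚ.≤ A → ℚ.∣ d ∣ ℚ.≤ B → ℚ.∣ b ℚ.- d ∣ ℚ.< δ → ℚ.∣ a ℚ.- c ∣ ℚ.< η →
    ℚ.∣ a ℚ.* b ℚ.- c ℚ.* d ∣ ℚ.< A ℚ.* δ ℚ.+ B ℚ.* η
  *-close a b c d A B {δ} {η} A>0 B>0 a≤A d≤B bd<δ ac<η =
    ℚ.≤-<-trans
      (subst (ℚ._≤ ℚ.∣ a ∣ ℚ.* u ℚ.+ ℚ.∣ d ∣ ℚ.* v) (cong ℚ.∣_∣ (sym (regroup a b c d))) triangle)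
      (ℚ.≤-<-trans
        (ℚ.+-mono-≤
          (ℚ.*-monoʳ-≤-nonNeg u {{ℚ.∣-∣-nonNeg (b ℚ.- d)}} a≤A)
          (ℚ.*-monoʳ-≤-nonNeg v {{ℚ.∣-∣-nonNeg (a ℚ.- c)}} d≤B))
        (ℚ.+-mono-<
          (ℚ.*-monoʳ-<-pos A {{ℚ.positive A>0}} bd<δ)
          (ℚ.*-monoʳ-<-pos B {{ℚ.positive B>0}} ac<η)))
    where
      u = ℚ.∣ b ℚ.- d ∣
      v = ℚ.∣ a ℚ.- c ∣
      regroup : ∀ a b c d → a ℚ.* b ℚ.- c ℚ.* d ≡ a ℚ.* (b ℚ.- d) ℚ.+ d ℚ.* (a ℚ.- c)
      regroup = solve 4 (λ a b c d → a :* b :- c :* d := a :* (b :- d) :+ d :* (a :- c)) refl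
        where open +-*-Solver
      triangle : ℚ.∣ a ℚ.* (b ℚ.- d) ℚ.+ d ℚ.* (a ℚ.- c) ∣ ℚ.≤ ℚ.∣ a ∣ ℚ.* u ℚ.+ ℚ.∣ d ∣ ℚ.* v
      triangle = subst (ℚ.∣ a ℚ.* (b ℚ.- d) ℚ.+ d ℚ.* (a ℚ.- c) ∣ ℚ.≤_)
        (cong₂ ℚ._+_ (ℚ.∣p*q∣≡∣p∣*∣q∣ a (b ℚ.- d)) (ℚ.∣p*q∣≡∣p∣*∣q∣ d (a ℚ.- c)))
        (ℚ.∣p+q∣≤∣p∣+∣q∣ (a ℚ.* (b ℚ.- d)) (d ℚ.* (a ℚ.- c)))

  *-close-seq : ∀ {x y : ℕ → ℚ} ε →
    (∃ λ A → 0ℚ ℚ.< A × ∃ λ N → ∀ n → N ℕ.≤ n → ℚ.∣ x n ∣ ℚ.≤ A) →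
    (∃ λ B → 0ℚ ℚ.< B × ∃ λ N → ∀ n → N ℕ.≤ n → ℚ.∣ y n ∣ ℚ.≤ B) →
    (∀ A → 0ℚ ℚ.< A → ∃ λ δ → A ℚ.* δ ≡ ½ ℚ.* ε ×
      ∃ λ N → ∀ m n → N ℕ.≤ m → N ℕ.≤ n → ℚ.∣ y m ℚ.- y n ∣ ℚ.< δ) →
    (∀ B → 0ℚ ℚ.< B → ∃ λ η → B ℚ.* η ≡ ½ ℚ.* ε ×
      ∃ λ N → ∀ m n → N ℕ.≤ m → N ℕ.≤ n → ℚ.∣ x m ℚ.- x n ∣ ℚ.< η) →
    ∃ λ N → ∀ m n → N ℕ.≤ m → N ℕ.≤ n → ℚ.∣ x m ℚ.* y m ℚ.- x n ℚ.* y n ∣ ℚ.< ε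
  *-close-seq {x} {y} ε (A , A>0 , N₁ , hA) (B , B>0 , N₂ , hB) dy dx =
    combine (dy A A>0) (dx B B>0)
    where
      combine :
        (∃ λ δ → A ℚ.* δ ≡ ½ ℚ.* ε ×
          ∃ λ N → ∀ m n → N ℕ.≤ m → N ℕ.≤ n → ℚ.∣ y m ℚ.- y n ∣ ℚ.< δ) →
        (∃ λ η → B ℚ.* η ≡ ½ ℚ.* ε ×
          ∃ λ N → ∀ m n → N ℕ.≤ m → N ℕ.≤ n → ℚ.∣ x m ℚ.- x n ∣ ℚ.< η) →
        ∃ λ N → ∀ m n → N ℕ.≤ m → N ℕ.≤ n → ℚ.∣ x m ℚ.* y m ℚ.- x n ℚ.* y n ∣ ℚ.< ε
      combine (δ , Aδ , N₃ , hδ) (η , Bη , N₄ , hη) = (N₁ ⊔ N₂) ⊔ (N₃ ⊔ N₄) , λ m n m≥ n≥ →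
        subst (ℚ.∣ x m ℚ.* y m ℚ.- x n ℚ.* y n ∣ ℚ.<_)
          (trans (cong₂ ℚ._+_ Aδ Bη) (half+half ε))
          (*-close (x m) (y m) (x n) (y n) A B A>0 B>0
            (hA m (≥₁ m≥)) (hB n (≥₂ n≥))
            (hδ m n (≥₃ m≥) (≥₃ n≥)) (hη m n (≥₄ m≥) (≥₄ n≥)))
        where
          module _ {k} (k≥ : (N₁ ⊔ N₂) ⊔ (N₃ ⊔ N₄) ℕ.≤ k) where
            ≥₁₂ = ℕ.m⊔n≤o⇒m≤o (N₁ ⊔ N₂) (N₃ ⊔ N₄) k≥
            ≥₃₄ = ℕ.m⊔n≤o⇒n≤o (N₁ ⊔ N₂) (N₃ ⊔ N₄) k≥
            ≥₁ = ℕ.m⊔n≤o⇒m≤o N₁ N₂ ≥₁₂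
            ≥₂ = ℕ.m⊔n≤o⇒n≤o N₁ N₂ ≥₁₂
            ≥₃ = ℕ.m⊔n≤o⇒m≤o N₃ N₄ ≥₃₄
            ≥₄ = ℕ.m⊔n≤o⇒n≤o N₃ N₄ ≥₃₄

  *-cauchy : ∀ {x y} → IsCauchy x → IsCauchy y → IsCauchy (λ n → x n ℚ.* y n)
  *-cauchy {x} {y} cx cy ε ε>0 = *-close-seq {x} {y} ε (bounded {x} cx) (bounded {y} cy)
    (closeAt {y} cy) (closeAt {x} cx)
    where
      closeAt : ∀ {z} → IsCauchy z → ∀ A → 0ℚ ℚ.< A → ∃ λ δ → A ℚ.* δ ≡ ½ ℚ.* ε ×
        ∃ λ N → ∀ m n → N ℕ.≤ m → N ℕ.≤ n → ℚ.∣ z m ℚ.- z n ∣ ℚ.< δ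
      closeAt cz A A>0 = let δ , δ>0 , eq = divide A (½ ℚ.* ε) A>0 (half>0 ε>0)
                         in δ , eq , cz δ δ>0

fromℚ : ℚ → ℝ
fromℚ r = mkℝ (λ _ → r) λ ε ε>0 →
  0 , λ _ _ _ _ → subst (λ d → ℚ.∣ d ∣ ℚ.< ε) (sym (ℚ.+-inverseʳ r)) ε>0

infixl 6 _+_ _-_
infixl 7 _*_
infixr 8 _^_
infix  8 -_

0ℝ 1ℝ ½ℝ : ℝ
0ℝ = fromℚ 0ℚ
1ℝ = fromℚ 1ℚ
½ℝ = fromℚ ½

_+_ : ℝ → ℝ → ℝ
x + y = mkℝ (λ n → seq x n ℚ.+ seq y n) (+-cauchy {seq x} {seq y} (cauchy x) (cauchy y))

-_ : ℝ → ℝ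
- x = mkℝ (λ n → ℚ.- seq x n) (neg-cauchy {seq x} (cauchy x))

_-_ : ℝ → ℝ → ℝ
x - y = x + - y

_*_ : ℝ → ℝ → ℝ
x * y = mkℝ (λ n → seq x n ℚ.* seq y n) (*-cauchy {seq x} {seq y} (cauchy x) (cauchy y))

_^_ : ℝ → ℕ → ℝ
x ^ zero  = 1ℝ
x ^ suc k = x * x ^ k

sumℝ : List ℝ → ℝ
sumℝ = foldr _+_ 0ℝ

------------------------------------------------------------------------
-- The binary logarithm of a positive integer m, as the limit of
-- ⌊log₂ (m ^ k)⌋ / k.  By 2 ^ a ≤ m ^ k < 2 ^ (1 + a) for
-- a = ⌊log₂ (m ^ k)⌋, the k-th term is within 1 / k of log₂ m.

private
  m<2*[1+⌊m/2⌋] : ∀ m → m ℕ.< 2 ℕ.* suc ℕ.⌊ m /2⌋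
  m<2*[1+⌊m/2⌋] zero          = s≤s z≤n
  m<2*[1+⌊m/2⌋] (suc zero)    = s≤s (s≤s z≤n)
  m<2*[1+⌊m/2⌋] (suc (suc m)) =
    subst (suc (suc m) ℕ.<_) (sym (ℕ.*-suc 2 (suc ℕ.⌊ m /2⌋)))
      (s≤s (s≤s (m<2*[1+⌊m/2⌋] m)))

  2*⌊m/2⌋≤m : ∀ m → 2 ℕ.* ℕ.⌊ m /2⌋ ℕ.≤ m
  2*⌊m/2⌋≤m zero          = z≤n
  2*⌊m/2⌋≤m (suc zero)    = z≤n
  2*⌊m/2⌋≤m (suc (suc m)) =
    subst (ℕ._≤ suc (suc m)) (sym (ℕ.*-suc 2 ℕ.⌊ m /2⌋)) (s≤s (s≤s (2*⌊m/2⌋≤m m)))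

  ⌊log₂⌋-step : ∀ m → ⌊log₂ suc (suc m) ⌋ ≡ suc ⌊log₂ suc ℕ.⌊ m /2⌋ ⌋
  ⌊log₂⌋-step m = cong suc (sym (⌊log₂⌊n/2⌋⌋≡⌊log₂n⌋∸1 (suc (suc m))))

  2^⌊log₂⌋≤ : ∀ m → .{{ℕ.NonZero m}} → 2 ℕ.^ ⌊log₂ m ⌋ ℕ.≤ m
  2^⌊log₂⌋≤ = <-rec _ λ where
    zero          rec {{()}}
    (suc zero)    rec → s≤s z≤n
    (suc (suc m)) rec → subst (λ a → 2 ℕ.^ a ℕ.≤ suc (suc m)) (sym (⌊log₂⌋-step m))
      (ℕ.≤-trans (ℕ.*-monoʳ-≤ 2 (rec (s≤s (s≤s (ℕ.⌊n/2⌋≤n m))))) (2*⌊m/2⌋≤m (suc (suc m))))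

  <2^[1+⌊log₂⌋] : ∀ m → m ℕ.< 2 ℕ.^ suc ⌊log₂ m ⌋
  <2^[1+⌊log₂⌋] = <-rec _ λ where
    zero          rec → s≤s z≤n
    (suc zero)    rec → s≤s (s≤s z≤n)
    (suc (suc m)) rec → subst (λ a → suc (suc m) ℕ.< 2 ℕ.^ suc a) (sym (⌊log₂⌋-step m))
      (ℕ.<-≤-trans (m<2*[1+⌊m/2⌋] (suc (suc m)))
        (ℕ.*-monoʳ-≤ 2 (rec (s≤s (s≤s (ℕ.⌊n/2⌋≤n m))))))

  ^-reflects-< : ∀ a b → 2 ℕ.^ a ℕ.< 2 ℕ.^ b → a ℕ.< b
  ^-reflects-< a b lt = ℕ.≰⇒> λ b≤a → ℕ.<⇒≱ lt (ℕ.^-monoʳ-≤ 2 b≤a)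

  ^-reflects-≤ : ∀ a b → 2 ℕ.^ a ℕ.≤ 2 ℕ.^ b → a ℕ.≤ b
  ^-reflects-≤ a b le = ℕ.≮⇒≥ λ b<a → ℕ.≤⇒≯ le (ℕ.^-monoʳ-< 2 (s≤s (s≤s z≤n)) b<a)

  ^-swap : ∀ m i j → (m ℕ.^ i) ℕ.^ j ≡ (m ℕ.^ j) ℕ.^ i
  ^-swap m i j = trans (ℕ.^-*-assoc m i j)
    (trans (cong (m ℕ.^_) (ℕ.*-comm i j)) (sym (ℕ.^-*-assoc m j i)))

  logFloor : ℕ → ℕ → ℕ
  logFloor m k = ⌊log₂ m ℕ.^ suc k ⌋

  lower-ℕ : ∀ m a b k → 2 ℕ.^ a ℕ.≤ m ℕ.^ suc b →
    a ℕ.* suc k ℕ.≤ suc (logFloor m k) ℕ.* suc b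
  lower-ℕ m a b k h = ℕ.<⇒≤ (^-reflects-< (a ℕ.* suc k) (suc (logFloor m k) ℕ.* suc b) (begin-strict
    2 ℕ.^ (a ℕ.* suc k)                ≡⟨ ℕ.^-*-assoc 2 a (suc k) ⟨
    (2 ℕ.^ a) ℕ.^ suc k                ≤⟨ ℕ.^-monoˡ-≤ (suc k) h ⟩
    (m ℕ.^ suc b) ℕ.^ suc k            ≡⟨ ^-swap m (suc b) (suc k) ⟩
    (m ℕ.^ suc k) ℕ.^ suc b            <⟨ ℕ.^-monoˡ-< (suc b) (<2^[1+⌊log₂⌋] (m ℕ.^ suc k)) ⟩
    (2 ℕ.^ suc (logFloor m k)) ℕ.^ suc b  ≡⟨ ℕ.^-*-assoc 2 (suc (logFloor m k)) (suc b) ⟩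
    2 ℕ.^ (suc (logFloor m k) ℕ.* suc b)  ∎))
    where open ℕ.≤-Reasoning

  upper-ℕ : ∀ m a b k → .{{ℕ.NonZero m}} → m ℕ.^ suc b ℕ.≤ 2 ℕ.^ a →
    logFloor m k ℕ.* suc b ℕ.≤ a ℕ.* suc k
  upper-ℕ m a b k h = ^-reflects-≤ (logFloor m k ℕ.* suc b) (a ℕ.* suc k) (begin
    2 ℕ.^ (logFloor m k ℕ.* suc b)     ≡⟨ ℕ.^-*-assoc 2 (logFloor m k) (suc b) ⟨
    (2 ℕ.^ logFloor m k) ℕ.^ suc b     ≤⟨ ℕ.^-monoˡ-≤ (suc b) (2^⌊log₂⌋≤ (m ℕ.^ suc k) {{ℕ.m^n≢0 m (suc k)}}) ⟩
    (m ℕ.^ suc k) ℕ.^ suc b            ≡⟨ ^-swap m (suc k) (suc b) ⟩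
    (m ℕ.^ suc b) ℕ.^ suc k            ≤⟨ ℕ.^-monoˡ-≤ (suc k) h ⟩
    (2 ℕ.^ a) ℕ.^ suc k                ≡⟨ ℕ.^-*-assoc 2 a (suc k) ⟩
    2 ℕ.^ (a ℕ.* suc k)                ∎)
    where open ℕ.≤-Reasoning

  /-mono : ∀ a b i j → a ℕ.* suc j ℕ.≤ b ℕ.* suc i → + a ℚ./ suc i ℚ.≤ + b ℚ./ suc j
  /-mono a b i j h = ℚ.toℚᵘ-cancel-≤
    (ℚᵘ.≤-respˡ-≃ (ℚᵘ.≃-sym (ℚ.toℚᵘ-fromℚᵘ (mkℚᵘ (+ a) i)))
      (ℚᵘ.≤-respʳ-≃ (ℚᵘ.≃-sym (ℚ.toℚᵘ-fromℚᵘ (mkℚᵘ (+ b) j)))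
        (ℚᵘ.*≤* (subst₂ ℤ._≤_ (ℤ.pos-* a (suc j)) (ℤ.pos-* b (suc i)) (ℤ.+≤+ h)))))

  /-suc : ∀ a k → + suc a ℚ./ suc k ≡ + a ℚ./ suc k ℚ.+ + 1 ℚ./ suc k
  /-suc a k = ℚ.toℚᵘ-injective (ℚᵘ.≃-trans (ℚ.toℚᵘ-fromℚᵘ (mkℚᵘ (+ suc a) k))
    (ℚᵘ.≃-trans step (ℚᵘ.≃-sym (ℚᵘ.≃-trans
      (ℚ.toℚᵘ-homo-+ (+ a ℚ./ suc k) (+ 1 ℚ./ suc k))
      (ℚᵘ.+-cong (ℚ.toℚᵘ-fromℚᵘ (mkℚᵘ (+ a) k)) (ℚ.toℚᵘ-fromℚᵘ (mkℚᵘ (+ 1) k)))))))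
    where
      step : mkℚᵘ (+ suc a) k ℚᵘ.≃ mkℚᵘ (+ a) k ℚᵘ.+ mkℚᵘ (+ 1) k
      step = ℚᵘ.*≡* (trans (cong (λ z → z ℤ.* (+ (suc k ℕ.* suc k))) (cong +_ (ℕ.+-comm 1 a)))
        (trans (cong ((+ a ℤ.+ + 1) ℤ.*_) (ℤ.pos-* (suc k) (suc k)))
        (trans (sym (ℤ.*-assoc (+ a ℤ.+ + 1) (+ suc k) (+ suc k)))
          (cong (ℤ._* (+ suc k)) (ℤ.*-distribʳ-+ (+ suc k) (+ a) (+ 1))))))

  archimedean : ∀ ε → 0ℚ ℚ.< ε → ∃ λ N → ∀ n → N ℕ.≤ n → + 1 ℚ./ suc n ℚ.< ε
  archimedean (mkℚ (+ zero)  d _) (ℚ.*<* (ℤ.+<+ ()))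
  archimedean (mkℚ ℤ.-[1+ _ ] d _) (ℚ.*<* ())
  archimedean (mkℚ ℤ.+[1+ a ] d _) _ = suc d , λ n d<n → ℚ.toℚᵘ-cancel-<
    (ℚᵘ.<-respˡ-≃ (ℚᵘ.≃-sym (ℚ.toℚᵘ-fromℚᵘ (mkℚᵘ (+ 1) n)))
      (ℚᵘ.*<* (ℤ.+<+ (ℕ.<-≤-trans
        (s≤s (subst (ℕ._≤ n) (sym (ℕ.+-identityʳ (suc d))) d<n))
        (ℕ.m≤n*m (suc n) (suc a))))))

  ∣-∣-< : ∀ p q {ε} → p ℚ.- q ℚ.< ε → q ℚ.- p ℚ.< ε → ℚ.∣ p ℚ.- q ∣ ℚ.< ε
  ∣-∣-< p q {ε} h k with ℚ.∣p∣≡p∨∣p∣≡-p (p ℚ.- q)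
  ... | inj₁ eq = subst (ℚ._< ε) (sym eq) h
  ... | inj₂ eq = subst (ℚ._< ε) (sym (trans eq (flip p q))) k
    where
      flip : ∀ a b → ℚ.- (a ℚ.- b) ≡ b ℚ.- a
      flip = solve 2 (λ a b → :- (a :- b) := b :- a) refl where open +-*-Solver

  +⇒- : ∀ p q r → p ℚ.≤ q ℚ.+ r → p ℚ.- q ℚ.≤ r
  +⇒- p q r h = subst (p ℚ.- q ℚ.≤_) (cancel q r) (ℚ.+-monoˡ-≤ (ℚ.- q) h)
    where
      cancel : ∀ a b → a ℚ.+ b ℚ.- a ≡ b
      cancel = solve 2 (λ a b → a :+ b :- a := b) refl where open +-*-Solver

  logSeq : ℕ → ℕ → ℚ
  logSeq m k = + logFloor m k ℚ./ suc k

  logSeq-lower : ∀ m a b k → 2 ℕ.^ a ℕ.≤ m ℕ.^ suc b →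
    + a ℚ./ suc b ℚ.≤ logSeq m k ℚ.+ + 1 ℚ./ suc k
  logSeq-lower m a b k h = subst (+ a ℚ./ suc b ℚ.≤_) (/-suc (logFloor m k) k)
    (/-mono a (suc (logFloor m k)) b k (lower-ℕ m a b k h))

  logSeq-close : ∀ m → .{{ℕ.NonZero m}} → ∀ i j →
    logSeq m i ℚ.≤ logSeq m j ℚ.+ + 1 ℚ./ suc j
  logSeq-close m i j =
    logSeq-lower m (logFloor m i) i j (2^⌊log₂⌋≤ (m ℕ.^ suc i) {{ℕ.m^n≢0 m (suc i)}})

  logSeq-cauchy : ∀ m → .{{ℕ.NonZero m}} → IsCauchy (logSeq m)
  logSeq-cauchy m ε ε>0 with archimedean ε ε>0
  ... | N , hN = N , λ i j i≥ j≥ → ∣-∣-< (logSeq m i) (logSeq m j)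
    (ℚ.≤-<-trans (+⇒- (logSeq m i) (logSeq m j) _ (logSeq-close m i j)) (hN j j≥))
    (ℚ.≤-<-trans (+⇒- (logSeq m j) (logSeq m i) _ (logSeq-close m j i)) (hN i i≥))

log₂ : (m : ℕ) → .{{ℕ.NonZero m}} → ℝ
log₂ m = mkℝ (λ k → + ⌊log₂ m ℕ.^ suc k ⌋ ℚ./ suc k) (logSeq-cauchy m)

-- These two bounds determine log₂ m as a real number: they are
-- a / b ≤ log₂ m whenever 2 ^ (a / b) ≤ m, and a / b ≥ log₂ m whenever
-- 2 ^ (a / b) ≥ m.

log₂-lower : ∀ m a b → .{{_ : ℕ.NonZero m}} → .{{_ : ℕ.NonZero b}} →
  2 ℕ.^ a ℕ.≤ m ℕ.^ b → fromℚ (+ a ℚ./ b) ≤ log₂ m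
log₂-lower m a (suc b) h ε ε>0 with archimedean ε ε>0
... | N , hN = N , λ n n≥ → ℚ.≤-trans (logSeq-lower m a b n h)
  (ℚ.+-monoʳ-≤ (logSeq m n) (ℚ.<⇒≤ (hN n n≥)))

log₂-upper : ∀ m a b → .{{_ : ℕ.NonZero m}} → .{{_ : ℕ.NonZero b}} →
  m ℕ.^ b ℕ.≤ 2 ℕ.^ a → log₂ m ≤ fromℚ (+ a ℚ./ b)
log₂-upper m a (suc b) h ε ε>0 = 0 , λ n _ →
  ℚ.≤-trans (/-mono (logFloor m n) a n b (upper-ℕ m a b n h))
    (subst (ℚ._≤ + a ℚ./ suc b ℚ.+ ε) (ℚ.+-identityʳ (+ a ℚ./ suc b))
      (ℚ.+-monoʳ-≤ (+ a ℚ./ suc b) (ℚ.<⇒≤ ε>0)))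

------------------------------------------------------------------------
-- Families of subsets of the n-element set Fin n, given by their
-- characteristic functions (as Subset n is itself).

Family : ℕ → Set
Family n = Subset n → Bool

infix 4 _∈ᶠ_

_∈ᶠ_ : ∀ {n} → Subset n → Family n → Set
S ∈ᶠ ℱ = T (ℱ S)

subsets : ∀ n → List (Subset n)
subsets zero    = Vec.[] ∷ []
subsets (suc n) = map (outside Vec.∷_) (subsets n) ++ map (inside Vec.∷_) (subsets n)

members : ∀ {n} → Family n → List (Subset n)
members {n} ℱ = filterᵇ ℱ (subsets n)

card : ∀ {n} → Family n → ℕ
card ℱ = length (members ℱ)

IsUpperSet : ∀ {n} → Family n → Set
IsUpperSet ℱ = ∀ A B → A ∈ᶠ ℱ → A ⊆ B → B ∈ᶠ ℱ

IsNontrivial : ∀ {n} → Family n → Set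
IsNontrivial ℱ = (∃ λ S → S ∈ᶠ ℱ) × (∃ λ S → ¬ (S ∈ᶠ ℱ))

IsMinimal : ∀ {n} → Family n → Subset n → Set
IsMinimal ℱ S = S ∈ᶠ ℱ × ¬ (∃ λ R → R ∈ᶠ ℱ × R ⊂ S)

isMinimal? : ∀ {n} (ℱ : Family n) S → Dec (IsMinimal ℱ S)
isMinimal? ℱ S = T? (ℱ S) ×-dec ¬? (anySubset? λ R → T? (ℱ R) ×-dec R ⊂? S)

minimals : ∀ {n} → Family n → Family n
minimals ℱ S = isYes (isMinimal? ℱ S)

-- The 0 is only a base value for the maximum: a nontrivial upper set
-- has at least one minimal element.
ℓ₀ : ∀ {n} → Family n → ℕ
ℓ₀ ℱ = max 0 (map ∣_∣ (members (minimals ℱ)))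

ℓ : ∀ {n} → Family n → ℕ
ℓ ℱ = ℓ₀ ℱ ⊔ 2

ℓ-nonZero : ∀ {n} (ℱ : Family n) → ℕ.NonZero (ℓ ℱ)
ℓ-nonZero ℱ = ℕ.>-nonZero (ℕ.≤-trans (s≤s z≤n) (ℕ.m≤n⊔m (ℓ₀ ℱ) 2))

logℓ : ∀ {n} → Family n → ℝ
logℓ ℱ = log₂ (ℓ ℱ) {{ℓ-nonZero ℱ}}

μ : ∀ {n} → ℝ → Family n → ℝ
μ {n} p ℱ = sumℝ (map (λ S → p ^ ∣ S ∣ * (1ℝ - p) ^ (n ∸ ∣ S ∣)) (members ℱ))

InUnitInterval : ℝ → Set
InUnitInterval p = 0ℝ ≤ p × p ≤ 1ℝ

IsCriticalProbability : ∀ {n} → Family n → ℝ → Set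
IsCriticalProbability ℱ p = InUnitInterval p × μ p ℱ ≈ ½ℝ

IsCover : ∀ {n} → Family n → Family n → Set
IsCover 𝒢 ℱ = ∀ A → A ∈ᶠ ℱ → ∃ λ S → S ∈ᶠ 𝒢 × S ⊆ A

IsSmall : ∀ {n} → ℝ → Family n → Set
IsSmall {n} p ℱ = Σ (Family n) λ 𝒢 →
  IsCover 𝒢 ℱ × sumℝ (map (λ S → p ^ ∣ S ∣) (members 𝒢)) ≤ ½ℝ

IsExpectationThreshold : ∀ {n} → Family n → ℝ → Set
IsExpectationThreshold ℱ q =
  (InUnitInterval q × IsSmall q ℱ) ×
  (∀ p → InUnitInterval p → IsSmall p ℱ → p ≤ q)

TendsToInfinity : (ℕ → ℕ) → Set
TendsToInfinity a = ∀ M → ∃ λ N → ∀ n → N ℕ.≤ n → M ℕ.≤ a n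

NontrivialInformation : ℝ → (size : ℕ → ℕ) → (∀ n → Family (size n)) → (ℕ → ℝ) → Set
NontrivialInformation K size ℱ q =
  ∃ λ N → ∀ n → N ℕ.≤ n → K * q n * logℓ (ℱ n) < 1ℝ

{-# OPTIONS --safe #-}

-- The minimal elements of a nontrivial upper set ℱ cover it and are all
-- nonempty, so for r ≤ 1 / (2 |ℱ₀|) the sum of r ^ |S| over S ∈ ℱ₀ is at
-- most |ℱ₀| r ≤ 1 / 2.  Hence q(ℱ) ≥ 1 / (2 |ℱ₀|), and K q(ℱ) log ℓ(ℱ) < 1
-- forces |ℱ₀| > K log ℓ(ℱ) / 2.

module Submission where

open import Defs hiding (_-_)
open import Data.Bool.Properties using (T?)
open import Data.Fin.Subset using (Subset; _⊆_; ∣_∣; _-_)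
open import Data.Fin.Subset.Induction using (⊂-wellFounded; Acc; acc)
open import Data.Fin.Subset.Properties using (anySubset?; _⊂?_; ⊆-refl; ⊆-trans; x∈p⇒∣p-x∣<∣p∣)
open import Data.Integer.Base as ℤ using (+_; -[1+_])
import Data.Integer.Properties as ℤ
open import Data.List.Base using (_∷_; map; length)
open import Data.List.Relation.Unary.All as All using (All; []; _∷_)
open import Data.List.Relation.Unary.All.Properties using (all-filter)
open import Data.Nat.Base as ℕ using (ℕ; zero; suc; z≤n; s≤s; _⊔_)
import Data.Nat.Properties as ℕ
open import Data.Product.Base using (∃; _×_; _,_; proj₁; proj₂)
open import Data.Rational.Base as ℚ using (ℚ; mkℚ; 0ℚ; 1ℚ; ½)
open import Data.Rational.Literals using (fromℤ)
import Data.Rational.Properties as ℚ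
import Data.Rational.Unnormalised.Base as ℚᵘ
import Data.Rational.Unnormalised.Properties as ℚᵘ
open import Function.Base using (_∘_)
open import Relation.Binary.PropositionalEquality using (_≡_; refl; sym; trans; cong; subst)
open import Relation.Nullary using (¬_; yes; no; contradiction)
open import Relation.Nullary.Decidable using (toWitness; fromWitness; _×-dec_)

-- `fromℤ` supplies numerator and denominator directly, so comparisons reduce to integers without
-- normalising a fraction.
fromℕ : ℕ → ℚ
fromℕ n = fromℤ (+ n)

fromℕ-suc : ∀ n → fromℕ (suc n) ≡ 1ℚ ℚ.+ fromℕ n
fromℕ-suc n = ℚ.toℚᵘ-injective
  (ℚᵘ.≃-trans (ℚᵘ.*≡* (cong (λ z → (+ 1 ℤ.+ z) ℤ.* + 1) (sym (ℤ.*-identityʳ (+ n)))))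
    (ℚᵘ.≃-sym (ℚ.toℚᵘ-homo-+ 1ℚ (fromℕ n))))

fromℕ-mono-≤ : ∀ {m n} → m ℕ.≤ n → fromℕ m ℚ.≤ fromℕ n
fromℕ-mono-≤ m≤n = ℚ.*≤* (ℤ.*-monoʳ-≤-nonNeg (+ 1) (ℤ.+≤+ m≤n))

≤-fromℕ : ∀ r → ∃ λ n → r ℚ.≤ fromℕ n
≤-fromℕ (mkℚ (+ n) d _)    = n , ℚ.*≤* (ℤ.*-monoˡ-≤-nonNeg (+ n) (ℤ.+≤+ (s≤s z≤n)))
≤-fromℕ (mkℚ -[1+ n ] d _) = 0 , ℚ.*≤* ℤ.-≤+

-- The comparison passes through `a * d`, which is why the sign hypotheses concern `a` and `d`.
*-mono-≤ : ∀ {a b c d} → 0ℚ ℚ.≤ a → 0ℚ ℚ.≤ d → a ℚ.≤ b → c ℚ.≤ d → a ℚ.* c ℚ.≤ b ℚ.* d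
*-mono-≤ {a} {b} {c} {d} 0≤a 0≤d a≤b c≤d = ℚ.≤-trans
  (ℚ.*-monoˡ-≤-nonNeg a {{ℚ.nonNegative 0≤a}} c≤d)
  (ℚ.*-monoʳ-≤-nonNeg d {{ℚ.nonNegative 0≤d}} a≤b)

*-pos : ∀ {a b} → 0ℚ ℚ.< a → 0ℚ ℚ.< b → 0ℚ ℚ.< a ℚ.* b
*-pos {a} {b} 0<a 0<b = ℚ.positive⁻¹ (a ℚ.* b)
  {{ℚ.pos*pos⇒pos a {{ℚ.positive 0<a}} b {{ℚ.positive 0<b}}}}

½>0 : 0ℚ ℚ.< ½
½>0 = ℚ.positive⁻¹ ½

reciprocal : ∀ r → 0ℚ ℚ.< r → ∃ λ s → 0ℚ ℚ.< s × r ℚ.* s ≡ 1ℚ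
reciprocal r 0<r = ℚ.1/ r , ℚ.positive⁻¹ (ℚ.1/ r) {{ℚ.1/pos⇒pos r}} , ℚ.*-inverseʳ r
  where
    instance
      r-pos = ℚ.positive 0<r
      r≢0 = ℚ.pos⇒nonZero r

-- This `r` is the probability later tested for smallness. The successor keeps the denominator
-- positive even for `n = 0`.
1/2[1+_] : ∀ n → ∃ λ r → 0ℚ ℚ.< r × r ℚ.≤ 1ℚ × fromℕ (suc n) ℚ.* r ≡ ½
1/2[1+ n ] = r , *-pos ½>0 s>0 , r≤1 , [1+n]r≡½
  where
    open ℚ.≤-Reasoning
    inverse = reciprocal (fromℕ (suc n)) (ℚ.positive⁻¹ _)
    s = proj₁ inverse
    s>0 = proj₁ (proj₂ inverse)
    r = ½ ℚ.* s
    [1+n]r≡½ : fromℕ (suc n) ℚ.* r ≡ ½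
    [1+n]r≡½ = begin-equality
      fromℕ (suc n) ℚ.* (½ ℚ.* s)  ≡⟨ cong (fromℕ (suc n) ℚ.*_) (ℚ.*-comm ½ s) ⟩
      fromℕ (suc n) ℚ.* (s ℚ.* ½)  ≡⟨ ℚ.*-assoc (fromℕ (suc n)) s ½ ⟨
      fromℕ (suc n) ℚ.* s ℚ.* ½    ≡⟨ cong (ℚ._* ½) (proj₂ (proj₂ inverse)) ⟩
      ½                            ∎
    r≤1 : r ℚ.≤ 1ℚ
    r≤1 = begin
      r                    ≡⟨ ℚ.*-identityˡ r ⟨
      1ℚ ℚ.* r             ≤⟨ ℚ.*-monoʳ-≤-nonNeg r {{ℚ.nonNegative (ℚ.<⇒≤ (*-pos ½>0 s>0))}}
                                (fromℕ-mono-≤ {1} {suc n} (s≤s z≤n)) ⟩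
      fromℕ (suc n) ℚ.* r  ≡⟨ [1+n]r≡½ ⟩
      ½                    ≤⟨ toWitness {a? = ½ ℚ.≤? 1ℚ} _ ⟩
      1ℚ                   ∎

fromℚ-mono-≤ : ∀ {r s} → r ℚ.≤ s → fromℚ r ≤ fromℚ s
fromℚ-mono-≤ {r} {s} r≤s ε ε>0 = 0 , λ _ _ →
  subst (ℚ._≤ s ℚ.+ ε) (ℚ.+-identityʳ r) (ℚ.+-mono-≤ r≤s (ℚ.<⇒≤ ε>0))

-- Sums and powers of reals compute index by index, so a bound on a whole sum can be proved in ℚ at
-- each index `k` and then transferred.
seq≤⇒≤ : ∀ x r → (∀ k → seq x k ℚ.≤ r) → x ≤ fromℚ r
seq≤⇒≤ x r h ε ε>0 = 0 , λ k _ →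
  subst (ℚ._≤ r ℚ.+ ε) (ℚ.+-identityʳ (seq x k)) (ℚ.+-mono-≤ (h k) (ℚ.<⇒≤ ε>0))

module _ {r} (0≤r : 0ℚ ℚ.≤ r) (r≤1 : r ℚ.≤ 1ℚ) where

  mutual
    seq-^-≤1 : ∀ m k → seq (fromℚ r ^ m) k ℚ.≤ 1ℚ
    seq-^-≤1 zero    k = ℚ.≤-refl
    seq-^-≤1 (suc m) k = ℚ.≤-trans (seq-^-≤ m k) r≤1

    -- One factor `r` remains while the rest of the power is at most `1`. The exponent must be
    -- positive: exponent zero allows only the bound `1`.
    seq-^-≤ : ∀ m k → seq (fromℚ r ^ suc m) k ℚ.≤ r
    seq-^-≤ m k = subst (seq (fromℚ r ^ suc m) k ℚ.≤_) (ℚ.*-identityʳ r)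
      (ℚ.*-monoˡ-≤-nonNeg r {{ℚ.nonNegative 0≤r}} (seq-^-≤1 m k))

seq-sumℝ-≤ : ∀ {A : Set} (f : A → ℝ) r k {xs} → All (λ x → seq (f x) k ℚ.≤ r) xs →
  seq (sumℝ (map f xs)) k ℚ.≤ fromℕ (length xs) ℚ.* r
seq-sumℝ-≤ f r k []                          = ℚ.≤-reflexive (sym (ℚ.*-zeroˡ r))
seq-sumℝ-≤ f r k {xs = x ∷ xs} (fx≤r ∷ fxs≤r) = begin
  seq (f x) k ℚ.+ seq (sumℝ (map f xs)) k    ≤⟨ ℚ.+-mono-≤ fx≤r (seq-sumℝ-≤ f r k fxs≤r) ⟩
  r ℚ.+ fromℕ (length xs) ℚ.* r              ≡⟨ cong (ℚ._+ fromℕ (length xs) ℚ.* r) (ℚ.*-identityˡ r) ⟨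
  1ℚ ℚ.* r ℚ.+ fromℕ (length xs) ℚ.* r       ≡⟨ ℚ.*-distribʳ-+ r 1ℚ (fromℕ (length xs)) ⟨
  (1ℚ ℚ.+ fromℕ (length xs)) ℚ.* r           ≡⟨ cong (ℚ._* r) (fromℕ-suc (length xs)) ⟨
  fromℕ (suc (length xs)) ℚ.* r              ∎
  where open ℚ.≤-Reasoning

+-cancelʳ-≤ : ∀ {a b} c → a ℚ.+ c ℚ.≤ b ℚ.+ c → a ℚ.≤ b
+-cancelʳ-≤ {a} {b} c h = begin
  a                    ≡⟨ cancel a ⟨
  a ℚ.+ c ℚ.+ ℚ.- c    ≤⟨ ℚ.+-monoˡ-≤ (ℚ.- c) h ⟩
  b ℚ.+ c ℚ.+ ℚ.- c    ≡⟨ cancel b ⟩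
  b                    ∎
  where
    open ℚ.≤-Reasoning
    cancel : ∀ x → x ℚ.+ c ℚ.+ ℚ.- c ≡ x
    cancel x = trans (ℚ.+-assoc x c (ℚ.- c))
      (trans (cong (x ℚ.+_) (ℚ.+-inverseʳ c)) (ℚ.+-identityʳ x))

½r+½r≡r : ∀ r → ½ ℚ.* r ℚ.+ ½ ℚ.* r ≡ r
½r+½r≡r r = trans (sym (ℚ.*-distribʳ-+ r ½ ½)) (ℚ.*-identityˡ r)

-- K ≥ ε, q ≥ r / 2 and L ≥ a - 1 hold eventually, so a is chosen with
-- ε (r / 2) (a - 1) ≥ 1.
product-≮1 : ∀ K → 0ℝ < K → ∀ r → 0ℚ ℚ.< r → ∃ λ a → ∀ q L →
  fromℚ r ≤ q → fromℚ (fromℕ a) ≤ L → ¬ (K * q * L < 1ℝ)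
product-≮1 K (ε , ε>0 , N₁ , K≥ε) r r>0 = a , λ q L r≤q a≤L (η , η>0 , N₂ , KqL≤1-η) →
  let N₃ , q≥r/2 = r≤q δ δ>0
      N₄ , L≥a-1 = a≤L 1ℚ (ℚ.positive⁻¹ 1ℚ)
      k = (N₁ ⊔ N₂) ⊔ (N₃ ⊔ N₄)
      ≥₁₂ = ℕ.m≤m⊔n (N₁ ⊔ N₂) (N₃ ⊔ N₄)
      ≥₃₄ = ℕ.m≤n⊔m (N₁ ⊔ N₂) (N₃ ⊔ N₄)
      ε≤K = subst (ℚ._≤ seq K k) (ℚ.+-identityˡ ε) (K≥ε k (ℕ.m⊔n≤o⇒m≤o N₁ N₂ ≥₁₂))
      δ≤q = +-cancelʳ-≤ δ (subst (ℚ._≤ seq q k ℚ.+ δ) (sym (½r+½r≡r r))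
        (q≥r/2 k (ℕ.m⊔n≤o⇒m≤o N₃ N₄ ≥₃₄)))
      b≤L = +-cancelʳ-≤ 1ℚ (ℚ.≤-trans b+1≤a (L≥a-1 k (ℕ.m⊔n≤o⇒n≤o N₃ N₄ ≥₃₄)))
      εδ≤Kq = *-mono-≤ (ℚ.<⇒≤ ε>0) (ℚ.≤-trans (ℚ.<⇒≤ δ>0) δ≤q) ε≤K δ≤q
      1≤KqL = subst (ℚ._≤ seq (K * q * L) k) εδb≡1
        (*-mono-≤ (ℚ.<⇒≤ εδ>0) (ℚ.≤-trans (ℚ.<⇒≤ b>0) b≤L) εδ≤Kq b≤L)
  -- At index `k` the product is at least `1`, while the strict inequality puts it at least `η`
  -- below `1`.
  in ℚ.<-irrefl refl (ℚ.<-≤-trans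
       (ℚ.+-mono-≤-< (1≤KqL) η>0)
       (ℚ.≤-trans (KqL≤1-η k (ℕ.m⊔n≤o⇒n≤o N₁ N₂ ≥₁₂)) (ℚ.≤-reflexive (sym (ℚ.+-identityʳ 1ℚ)))))
  where
    δ = ½ ℚ.* r
    δ>0 = *-pos ½>0 r>0
    εδ>0 = *-pos ε>0 δ>0
    inverse = reciprocal (ε ℚ.* δ) εδ>0
    b = proj₁ inverse
    b>0 = proj₁ (proj₂ inverse)
    εδb≡1 = proj₂ (proj₂ inverse)
    bound = ≤-fromℕ (b ℚ.+ 1ℚ)
    a = proj₁ bound
    b+1≤a = proj₂ bound

-- Only arbitrarily large lower bounds on the logarithm are needed, so integer values, the case of
-- denominator `1`, suffice.
2^a≤m⇒a≤log₂ : ∀ m a → .{{_ : ℕ.NonZero m}} → 2 ℕ.^ a ℕ.≤ m → fromℚ (fromℕ a) ≤ log₂ m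
2^a≤m⇒a≤log₂ m a 2^a≤m = subst (λ r → fromℚ r ≤ log₂ m) (ℚ.↥p/↧p≡p (fromℕ a))
  (log₂-lower m a 1 (subst (2 ℕ.^ a ℕ.≤_) (sym (ℕ.^-identityʳ m)) 2^a≤m))

-- Removing an element `x` of `S` would leave a set of size below zero.
∣S∣≡0⇒S⊆T : ∀ {n} (S T : Subset n) → ∣ S ∣ ≡ 0 → S ⊆ T
∣S∣≡0⇒S⊆T S T ∣S∣≡0 {x} x∈S =
  contradiction (subst (∣ S - x ∣ ℕ.<_) ∣S∣≡0 (x∈p⇒∣p-x∣<∣p∣ x∈S)) λ ()

-- Well-founded descent along strict inclusion: either no member lies strictly below `A`, so `A` is
-- minimal, or the search continues from such a member.
minimals-cover : ∀ {n} (ℱ : Family n) → IsCover (minimals ℱ) ℱ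
minimals-cover ℱ A = go A (⊂-wellFounded A)
  where
    go : ∀ A → Acc _ A → A ∈ᶠ ℱ → ∃ λ S → S ∈ᶠ minimals ℱ × S ⊆ A
    go A (acc rec) A∈ℱ with anySubset? (λ R → T? (ℱ R) ×-dec R ⊂? A)
    ... | no ∄R = A , fromWitness {a? = isMinimal? ℱ A} (A∈ℱ , ∄R) , ⊆-refl
    ... | yes (R , R∈ℱ , R⊂A) =
      let S , S∈min , S⊆R = go R (rec R⊂A) R∈ℱ
      in S , S∈min , ⊆-trans S⊆R (proj₁ R⊂A)

minimals-small : ∀ {n} {ℱ : Family n} → IsUpperSet ℱ → (∃ λ S → ¬ (S ∈ᶠ ℱ)) →
  ∀ {r} → 0ℚ ℚ.≤ r → r ℚ.≤ 1ℚ → fromℕ (card (minimals ℱ)) ℚ.* r ℚ.≤ ½ →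
  IsSmall (fromℚ r) ℱ
minimals-small {ℱ = ℱ} upper (B , B∉ℱ) {r} 0≤r r≤1 mr≤½ =
  minimals ℱ , minimals-cover ℱ ,
  seq≤⇒≤ (sumℝ (map (λ S → fromℚ r ^ ∣ S ∣) (members (minimals ℱ)))) ½ λ k →
    ℚ.≤-trans
      (seq-sumℝ-≤ (λ S → fromℚ r ^ ∣ S ∣) r k
        (All.map (λ {S} → term-≤ k S) (all-filter (T? ∘ minimals ℱ) (subsets _))))
      mr≤½
  where
    term-≤ : ∀ k S → S ∈ᶠ minimals ℱ → seq (fromℚ r ^ ∣ S ∣) k ℚ.≤ r
    term-≤ k S S∈min with ∣ S ∣ in eq
    ... | suc m = seq-^-≤ 0≤r r≤1 m k
    -- An empty minimal element is contained in the nonmember `B`, so upward closure would force `B`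
    -- into `ℱ`.
    ... | zero  = contradiction
      (upper S B (proj₁ (toWitness {a? = isMinimal? ℱ S} S∈min)) (∣S∣≡0⇒S⊆T S B eq)) B∉ℱ

corollary5p6 : (size : ℕ → ℕ) (ℱ : ∀ n → Family (size n)) →
    (∀ n → IsUpperSet (ℱ n)) →
    (∀ n → IsNontrivial (ℱ n)) →
    (p-c q : ℕ → ℝ) →
    (∀ n → IsCriticalProbability (ℱ n) (p-c n)) →
    (∀ n → IsExpectationThreshold (ℱ n) (q n)) →
    (K : ℝ) → 0ℝ < K →
    (∀ n → p-c n ≤ K * q n * logℓ (ℱ n)) →
    TendsToInfinity (λ n → ℓ (ℱ n)) →
    NontrivialInformation K size ℱ q →
    TendsToInfinity (λ n → card (minimals (ℱ n)))
corollary5p6 size ℱ upper nontrivial p-c q _ threshold K K>0 _ ℓ→∞ (N₁ , informative) M =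
  let r , r>0 , r≤1 , [1+M]r≡½ = 1/2[1+ M ]
      -- `a` depends only on `K` and `r`, hence on `M`, so one choice serves every index `n`.
      a , product-large = product-≮1 K K>0 r r>0
      N₂ , ℓ-large = ℓ→∞ (2 ℕ.^ a)
      0≤r = ℚ.<⇒≤ r>0
      -- With `m < M` minimal elements, `m r ≤ (1 + M) r = 1/2`; thus `ℱ n` is `r`-small, and the
      -- maximality of `q n` gives `r ≤ q n`.
      r≤q = λ n m<M → proj₂ (threshold n) (fromℚ r)
        (fromℚ-mono-≤ 0≤r , fromℚ-mono-≤ r≤1)
        (minimals-small (upper n) (proj₂ (nontrivial n)) 0≤r r≤1
          (subst (fromℕ (card (minimals (ℱ n))) ℚ.* r ℚ.≤_) [1+M]r≡½
            (ℚ.*-monoʳ-≤-nonNeg r {{ℚ.nonNegative 0≤r}}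
              (fromℕ-mono-≤ (ℕ.m≤n⇒m≤1+n (ℕ.<⇒≤ m<M))))))
  in N₁ ⊔ N₂ , λ n n≥ → ℕ.≮⇒≥ λ m<M →
       -- Fewer than `M` minimal elements would keep `q n` at least `r` while the logarithm is at
       -- least `a`, so the product could not stay below `1`.
       product-large (q n) (logℓ (ℱ n)) (r≤q n m<M)
         (2^a≤m⇒a≤log₂ (ℓ (ℱ n)) a {{ℓ-nonZero (ℱ n)}} (ℓ-large n (ℕ.m⊔n≤o⇒n≤o N₁ N₂ n≥)))
         (informative n (ℕ.m⊔n≤o⇒m≤o N₁ N₂ n≥))
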